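{- Up to $\mathrm{Grz}$-equivalence there are exactly six $\mathrm{Grz}$-additive formulas without parameters (i.e. formulas in $\mathrm{Fm}(p)$): $\bot$, $p$, $\Diamond p$, $\top$, $\Diamond\Box p$, and $\Diamond\Box p\vee p$. Exactly five of them (all except $\top$) are normal in $\mathrm{Grz}$.
   Context: $\mathrm{Fm}(p)$ is the set of modal formulas (built with Boolean connectives, $\bot,\top,\Diamond,\Box$) containing no variables other than $p$. For a normal modal logic $\Lambda$, formulas $\varphi,\psi$ are $\Lambda$-equivalent if $\Lambda\vdash\varphi\leftrightarrow\psi$. A formula $\varphi(p)$ is $\Lambda$-additive if $\Lambda\vdash\varphi(p\vee q)\leftrightarrow\varphi(p)\vee\varphi(q)$ (with $q$ a variable distinct from $p$), and normal in $\Lambda$ if $\Lambda\vdash\varphi(\bot)\leftrightarrow\bot$. $\mathrm{Grz}$ is Grzegorczyk's logic, the normal modal logic $\mathrm{K}$ plus $\Box(\Box(p\to\Box p)\to p)\to p$; equivalently, the logic of all finite partially ordered (reflexive) frames. -}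

module Defs where

open import Level using (0ℓ)
open import Data.Bool.Base using (Bool; true; false; not; _∧_; _∨_; if_then_else_)
open import Data.Nat.Base using (ℕ)
open import Data.Nat.Properties using (_≟_)
open import Data.List.Base using (List; []; _∷_)
open import Data.Product.Base using (_×_)
open import Data.Unit.Base using (⊤)
open import Relation.Nullary.Decidable.Core using (does)
open import Relation.Unary using (Pred)
open import Relation.Binary.PropositionalEquality.Core using (_≡_)

Var : Set
Var = ℕ

infix  9 □_ ◇_ ¬ᶠ_
infixr 7 _∧ᶠ_
infixr 6 _∨ᶠ_
infixr 5 _⇒_
infix  4 _⇔ᶠ_

data Fm : Set where
  var            : Var → Fm
  ⊥ᶠ ⊤ᶠ          : Fm
  _∧ᶠ_ _∨ᶠ_ _⇒_  : Fm → Fm → Fm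
  □_ ◇_          : Fm → Fm

¬ᶠ_ : Fm → Fm
¬ᶠ φ = φ ⇒ ⊥ᶠ

_⇔ᶠ_ : Fm → Fm → Fm
φ ⇔ᶠ ψ = (φ ⇒ ψ) ∧ᶠ (ψ ⇒ φ)

-- φ ∈Fm p: no variable other than p occurs in φ.
infix 4 _∈Fm_
_∈Fm_ : Fm → Var → Set
var x     ∈Fm p = x ≡ p
⊥ᶠ        ∈Fm p = ⊤
⊤ᶠ        ∈Fm p = ⊤
(φ ∧ᶠ ψ)  ∈Fm p = (φ ∈Fm p) × (ψ ∈Fm p)
(φ ∨ᶠ ψ)  ∈Fm p = (φ ∈Fm p) × (ψ ∈Fm p)
(φ ⇒ ψ)   ∈Fm p = (φ ∈Fm p) × (ψ ∈Fm p)
(□ φ)     ∈Fm p = φ ∈Fm p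
(◇ φ)     ∈Fm p = φ ∈Fm p

subst : (Var → Fm) → Fm → Fm
subst σ (var x)   = σ x
subst σ ⊥ᶠ        = ⊥ᶠ
subst σ ⊤ᶠ        = ⊤ᶠ
subst σ (φ ∧ᶠ ψ)  = subst σ φ ∧ᶠ subst σ ψ
subst σ (φ ∨ᶠ ψ)  = subst σ φ ∨ᶠ subst σ ψ
subst σ (φ ⇒ ψ)   = subst σ φ ⇒ subst σ ψ
subst σ (□ φ)     = □ subst σ φ
subst σ (◇ φ)     = ◇ subst σ φ

infix 10 _[_≔_]
_[_≔_] : Fm → Var → Fm → Fm
φ [ p ≔ ψ ] = subst (λ x → if does (x ≟ p) then ψ else var x) φ

-- Classical truth value, where variables and formulas beginning with □ or ◇
-- count as propositional atoms, valued by v.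
eval : (Fm → Bool) → Fm → Bool
eval v (var x)   = v (var x)
eval v ⊥ᶠ        = false
eval v ⊤ᶠ        = true
eval v (φ ∧ᶠ ψ)  = eval v φ ∧ eval v ψ
eval v (φ ∨ᶠ ψ)  = eval v φ ∨ eval v ψ
eval v (φ ⇒ ψ)   = not (eval v φ) ∨ eval v ψ
eval v (□ φ)     = v (□ φ)
eval v (◇ φ)     = v (◇ φ)

Tautology : Fm → Set
Tautology φ = ∀ v → eval v φ ≡ true

-- A logic is identified with its set of theorems.
Logic : Set₁
Logic = Pred Fm 0ℓ

-- K+ α is the least normal modal logic containing α. As □ and ◇ are both
-- primitive, their duality is an axiom.
data K+ (α : Fm) : Logic where
  taut : ∀ {φ} → Tautology φ → K+ α φ
  K    : ∀ {φ ψ} → K+ α (□ (φ ⇒ ψ) ⇒ (□ φ ⇒ □ ψ))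
  dual : ∀ {φ} → K+ α (◇ φ ⇔ᶠ ¬ᶠ □ ¬ᶠ φ)
  ax   : K+ α α
  mp   : ∀ {φ ψ} → K+ α (φ ⇒ ψ) → K+ α φ → K+ α ψ
  nec  : ∀ {φ} → K+ α φ → K+ α (□ φ)
  sub  : ∀ {φ} σ → K+ α φ → K+ α (subst σ φ)

Grz : Logic
Grz = K+ (□ (□ (p ⇒ □ p) ⇒ p) ⇒ p)
  where p = var 0

Equivalent : Logic → Fm → Fm → Set
Equivalent Λ φ ψ = Λ (φ ⇔ᶠ ψ)

-- φ is regarded as φ(p); q is meant to be a variable distinct from p and
-- not occurring in φ.
Additive : Logic → (p q : Var) → Fm → Set
Additive Λ p q φ =
  Equivalent Λ (φ [ p ≔ var p ∨ᶠ var q ]) (φ ∨ᶠ φ [ p ≔ var q ])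

NormalIn : Logic → (p : Var) → Fm → Set
NormalIn Λ p φ = Equivalent Λ (φ [ p ≔ ⊥ᶠ ]) ⊥ᶠ

sixFormulas : Var → List Fm
sixFormulas x = ⊥ᶠ ∷ p ∷ ◇ p ∷ ⊤ᶠ ∷ ◇ □ p ∷ (◇ □ p ∨ᶠ p) ∷ []
  where p = var x

{-# OPTIONS --safe #-}

-- Grz is sound and complete for finite trees, so φ(p) may be studied as a
-- Boolean function of trees with marked nodes, the marks being the value of p.
-- If φ is additive and φ(⊥) is not ⊤, then φ holds at the root of a tree iff it
-- does so after all marks but a suitable one are erased.  Up to bisimilarity
-- there are only six trees with exactly one mark.  Additivity, applied to trees
-- with two marks, expresses the value of φ on them through the values a₁, a₂ and
-- a₃ on the 2-chain marked at the bottom, the 2-chain marked at the top and the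
-- 3-chain marked in the middle, and shows that a₃ implies a₁ and a₂.  The five
-- remaining triples are those of ⊥, p, ◇p, ◇□p and ◇□p ∨ p.
module Submission where

open import Defs
open import Algebra.Bundles using (CommutativeMonoid)
open import Data.Bool.Base using (Bool; true; false; not; _∧_; _∨_; if_then_else_)
open import Data.Bool.Properties
  using (¬-not; not-injective; ∧-conicalˡ; ∧-conicalʳ; ∧-zeroʳ; ∨-idem; ∨-identityʳ;
         ∧-commutativeMonoid; ∨-commutativeMonoid; ∨-∧-booleanAlgebra)
open import Algebra.Lattice.Properties.BooleanAlgebra ∨-∧-booleanAlgebra using (deMorgan₁; deMorgan₂)
open import Algebra.Properties.CommutativeSemigroup (CommutativeMonoid.commutativeSemigroup ∧-commutativeMonoid)
  using () renaming (interchange to ∧-interchange)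
open import Algebra.Properties.CommutativeSemigroup (CommutativeMonoid.commutativeSemigroup ∨-commutativeMonoid)
  using () renaming (interchange to ∨-interchange)
open import Data.Empty using (⊥; ⊥-elim)
open import Data.List.Base using (List; []; _∷_; _++_; concatMap; map)
open import Data.List.Membership.Propositional using (_∈_; find; lose)
open import Data.List.Membership.Propositional.Properties using (∈-map⁺; ∈-++⁺ˡ; ∈-++⁺ʳ; ∈-concatMap⁺)
open import Data.List.Relation.Binary.Subset.Propositional using (_⊆_)
open import Data.List.Relation.Unary.All using (All; []; _∷_)
import Data.List.Relation.Unary.All as All
import Data.List.Relation.Unary.All.Properties as All
open import Data.List.Relation.Unary.AllPairs using (AllPairs; []; _∷_)
open import Data.List.Relation.Unary.Any using (Any; here; there)
import Data.List.Relation.Unary.Any as Any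
import Data.List.Relation.Unary.Any.Properties as Any
open import Data.Nat.Base using (ℕ; suc; _+_; _≤_; _<_; z≤n; s≤s)
open import Data.Nat.Properties using (_≟_; ≤-refl; <-≤-trans; +-mono-≤; +-mono-≤-<)
open import Data.Product using (_×_; _,_; proj₁; proj₂; ∃; Σ-syntax)
open import Data.Sum using (_⊎_; inj₁; inj₂)
open import Data.Unit using (⊤; tt)
open import Function.Base using (id; _∘_)
open import Function.Bundles using (_⇔_; mk⇔)
open import Relation.Nullary using (¬_; yes; no; does)
open import Relation.Nullary.Decidable using (map′; _×-dec_; dec-true; dec-false)
open import Relation.Binary.Definitions using (DecidableEquality)
open import Relation.Binary.PropositionalEquality using (_≡_; _≢_; refl; sym; trans; cong; cong₂)

-- Equivalence in `Grz` asks for an actual derivation, and no excluded middle is available.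
-- Completeness is therefore a terminating search that returns a derivation or a countermodel. With
-- one mark there remain three questions: is the mark at the root, is there a node above it, and
-- from which nodes below it can an unmarked leaf be reached. Additivity by itself says nothing
-- about a tree with one mark. It relates the shapes only after some shape is blown up to a
-- bisimilar tree with two marks, which trees allow since a branch may be copied and the copies
-- marked independently.

contradictory : ∀ {b} {X : Set} → b ≡ true → b ≡ false → X
contradictory refl ()

≡-by-truth : ∀ {a b} → (a ≡ true → b ≡ true) → (b ≡ true → a ≡ true) → a ≡ b
≡-by-truth {true}          f g = sym (f refl)
≡-by-truth {false} {true}  f g = g refl
≡-by-truth {false} {false} f g = refl

bool? : ∀ b → b ≡ true ⊎ b ≡ false
bool? true  = inj₁ refl
bool? false = inj₂ refl

implies : ∀ {a b} → (a ≡ true → b ≡ true) → not a ∨ b ≡ true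
implies {true}  f = f refl
implies {false} f = refl

implied : ∀ {a b} → not a ∨ b ≡ true → a ≡ true → b ≡ true
implied f refl = f

-- Derivations

-- A record, so that unification recovers `v` and `φ`; from the reducing term `eval v φ` it could
-- not.
infix 3 _⊨_
record _⊨_ (v : Fm → Bool) (φ : Fm) : Set where
  constructor holds
  field truth : eval v φ ≡ true
open _⊨_

module _ {v : Fm → Bool} where

  ⇒-intro : ∀ {φ ψ} → (v ⊨ φ → v ⊨ ψ) → v ⊨ φ ⇒ ψ
  ⇒-intro {φ} {ψ} f with eval v φ in eq
  ... | true  = holds (trans (cong (λ b → not b ∨ eval v ψ) eq) (truth (f (holds eq))))
  ... | false = holds (cong (λ b → not b ∨ eval v ψ) eq)

  ⇒-elim : ∀ {φ ψ} → v ⊨ φ ⇒ ψ → v ⊨ φ → v ⊨ ψ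
  ⇒-elim {φ} {ψ} (holds f) (holds x) = holds (trans (sym (cong (λ b → not b ∨ eval v ψ) x)) f)

  ∧-intro : ∀ {φ ψ} → v ⊨ φ → v ⊨ ψ → v ⊨ φ ∧ᶠ ψ
  ∧-intro (holds x) (holds y) = holds (cong₂ _∧_ x y)

  ∧-elimˡ : ∀ {φ ψ} → v ⊨ φ ∧ᶠ ψ → v ⊨ φ
  ∧-elimˡ (holds x) = holds (∧-conicalˡ _ _ x)

  ∧-elimʳ : ∀ {φ ψ} → v ⊨ φ ∧ᶠ ψ → v ⊨ ψ
  ∧-elimʳ {φ} (holds x) = holds (∧-conicalʳ (eval v φ) _ x)

  ⊥-elimᶠ : ∀ {φ} → v ⊨ ⊥ᶠ → v ⊨ φ
  ⊥-elimᶠ (holds ())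

  by-cases : ∀ φ {ψ} → (v ⊨ φ → v ⊨ ψ) → (v ⊨ ¬ᶠ φ → v ⊨ ψ) → v ⊨ ψ
  by-cases φ f g with eval v φ in eq
  ... | true  = f (holds eq)
  ... | false = g (holds (cong (λ b → not b ∨ false) eq))

  ⊨¬ : ∀ φ → eval v φ ≡ false → v ⊨ ¬ᶠ φ
  ⊨¬ φ eq = holds (cong (λ b → not b ∨ false) eq)

⊢_ : Fm → Set
⊢_ = Grz
infix 2 ⊢_

-- Propositional steps are argued at an arbitrary valuation with the natural deduction rules above,
-- and `taut` and `mp` turn the argument into a derivation.
infer₀ : ∀ {φ} → (∀ v → v ⊨ φ) → ⊢ φ
infer₀ f = taut λ v → truth (f v)

infer₁ : ∀ {φ ψ} → (∀ v → v ⊨ φ → v ⊨ ψ) → ⊢ φ → ⊢ ψ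
infer₁ f d = mp (infer₀ λ v → ⇒-intro (f v)) d

infer₂ : ∀ {φ ψ χ} → (∀ v → v ⊨ φ → v ⊨ ψ → v ⊨ χ) → ⊢ φ → ⊢ ψ → ⊢ χ
infer₂ f d e = mp (infer₁ (λ v x → ⇒-intro (f v x)) d) e

⇒-trans : ∀ {φ ψ χ} → ⊢ φ ⇒ ψ → ⊢ ψ ⇒ χ → ⊢ φ ⇒ χ
⇒-trans = infer₂ λ v f g → ⇒-intro λ x → ⇒-elim g (⇒-elim f x)

□-mono : ∀ {φ ψ} → ⊢ φ ⇒ ψ → ⊢ □ φ ⇒ □ ψ
□-mono d = mp K (nec d)

grz : ∀ φ → ⊢ □ (□ (φ ⇒ □ φ) ⇒ φ) ⇒ φ
grz φ = sub (λ _ → φ) ax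

-- Since `φ` implies anything that has `φ` as consequent, `□ φ` yields the antecedent of the
-- Grzegorczyk axiom.
reflexivity : ∀ φ → ⊢ □ φ ⇒ φ
reflexivity φ = ⇒-trans (□-mono (infer₀ λ v → ⇒-intro λ x → ⇒-intro λ _ → x)) (grz φ)

-- The Grzegorczyk axiom is applied to φ ∧ (□ φ ⇒ □ □ φ).
transitivity : ∀ φ → ⊢ □ φ ⇒ □ □ φ
transitivity φ = infer₂ (λ v f g → ⇒-intro λ x → ⇒-elim (∧-elimʳ (⇒-elim g (⇒-elim f x))) x)
                        (□-mono unfolded) (grz ψ)
  where
  ψ = φ ∧ᶠ (□ φ ⇒ □ □ φ)

  -- If `□ φ` fails, the second conjunct of `ψ` is vacuous, so `φ` gives `ψ`, hence `□ ψ` and with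
  -- it `□ φ` after all.
  step : ⊢ φ ⇒ (ψ ⇒ □ ψ) ⇒ □ φ
  step = infer₁ (λ v □ψ⇒□φ → ⇒-intro λ x → ⇒-intro λ f →
           by-cases (□ φ) (λ y → y) λ ¬□φ →
             ⇒-elim □ψ⇒□φ (⇒-elim f (∧-intro x (⇒-intro λ y → ⊥-elimᶠ (⇒-elim ¬□φ y)))))
         (□-mono (infer₀ λ v → ⇒-intro ∧-elimˡ))

  boxed : ⊢ □ φ ⇒ □ (ψ ⇒ □ ψ) ⇒ □ □ φ
  boxed = ⇒-trans (□-mono step) K

  unfolded : ⊢ φ ⇒ □ (ψ ⇒ □ ψ) ⇒ ψ
  unfolded = infer₁ (λ v f → ⇒-intro λ x → ⇒-intro λ y →
               ∧-intro x (⇒-intro λ z → ⇒-elim (⇒-elim f z) y)) boxed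

grz-□ : ∀ φ → ⊢ □ (□ (φ ⇒ □ φ) ⇒ φ) ⇒ □ φ
grz-□ φ = ⇒-trans (transitivity _) (□-mono (grz φ))

-- Semantics on finite trees

data Tree (A : Set) : Set where
  node : A → List (Tree A) → Tree A

module _ {A : Set} where

  label : Tree A → A
  label (node a ts) = a

  everywhere  : (Tree A → Bool) → Tree A → Bool
  everywhere* : (Tree A → Bool) → List (Tree A) → Bool
  everywhere f (node a ts) = f (node a ts) ∧ everywhere* f ts
  everywhere* f []       = true
  everywhere* f (t ∷ ts) = everywhere f t ∧ everywhere* f ts

  infix 4 _≼_
  data _≼_ (s : Tree A) : Tree A → Set where
    ≼-refl  : s ≼ s
    ≼-child : ∀ {a ts} → Any (s ≼_) ts → s ≼ node a ts

  everywhere-intro  : ∀ {f} t → (∀ {s} → s ≼ t → f s ≡ true) → everywhere f t ≡ true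
  everywhere*-intro : ∀ {f} ts → (∀ {s} → Any (s ≼_) ts → f s ≡ true) → everywhere* f ts ≡ true
  everywhere-intro (node a ts) h = cong₂ _∧_ (h ≼-refl) (everywhere*-intro ts (λ i → h (≼-child i)))
  everywhere*-intro []       h = refl
  everywhere*-intro (t ∷ ts) h =
    cong₂ _∧_ (everywhere-intro t (λ i → h (here i))) (everywhere*-intro ts (λ i → h (there i)))

  everywhere-root : ∀ {f} t → everywhere f t ≡ true → f t ≡ true
  everywhere-root (node a ts) e = ∧-conicalˡ _ _ e

  everywhere-children : ∀ {f} a ts → everywhere f (node a ts) ≡ true → everywhere* f ts ≡ true
  everywhere-children {f} a ts e = ∧-conicalʳ (f (node a ts)) _ e

  everywhere-elim  : ∀ {f s t} → everywhere f t ≡ true → s ≼ t → f s ≡ true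
  everywhere*-elim : ∀ {f s ts} → everywhere* f ts ≡ true → Any (s ≼_) ts → f s ≡ true
  everywhere-elim {t = t} e ≼-refl = everywhere-root t e
  everywhere-elim {t = node a ts} e (≼-child i) = everywhere*-elim (everywhere-children a ts e) i
  everywhere*-elim e (here i)  = everywhere-elim (∧-conicalˡ _ _ e) i
  everywhere*-elim {f} {ts = t ∷ ts} e (there i) = everywhere*-elim (∧-conicalʳ (everywhere f t) _ e) i

  everywhere-cong  : ∀ {f g} → (∀ t → f t ≡ g t) → ∀ t → everywhere f t ≡ everywhere g t
  everywhere*-cong : ∀ {f g} → (∀ t → f t ≡ g t) → ∀ ts → everywhere* f ts ≡ everywhere* g ts
  everywhere-cong h (node a ts) = cong₂ _∧_ (h (node a ts)) (everywhere*-cong h ts)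
  everywhere*-cong h []       = refl
  everywhere*-cong h (t ∷ ts) = cong₂ _∧_ (everywhere-cong h t) (everywhere*-cong h ts)

  -- A valuation reads the whole subtree above a node, not only its label. This makes valuations
  -- closed under substitution: the set of nodes where `σ x` holds is again one, as the rule `sub`
  -- requires.
  Valuation : Set
  Valuation = Tree A → Var → Bool

  sem : Valuation → Fm → Tree A → Bool
  sem v (var x)  t = v t x
  sem v ⊥ᶠ       t = false
  sem v ⊤ᶠ       t = true
  sem v (φ ∧ᶠ ψ) t = sem v φ t ∧ sem v ψ t
  sem v (φ ∨ᶠ ψ) t = sem v φ t ∨ sem v ψ t
  sem v (φ ⇒ ψ)  t = not (sem v φ t) ∨ sem v ψ t
  sem v (□ φ)    t = everywhere (sem v φ) t
  sem v (◇ φ)    t = not (everywhere (λ s → not (sem v φ s)) t)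

  sem-subst : ∀ v σ φ t → sem v (subst σ φ) t ≡ sem (λ s x → sem v (σ x) s) φ t
  sem-subst v σ (var x)  t = refl
  sem-subst v σ ⊥ᶠ       t = refl
  sem-subst v σ ⊤ᶠ       t = refl
  sem-subst v σ (φ ∧ᶠ ψ) t = cong₂ _∧_ (sem-subst v σ φ t) (sem-subst v σ ψ t)
  sem-subst v σ (φ ∨ᶠ ψ) t = cong₂ _∨_ (sem-subst v σ φ t) (sem-subst v σ ψ t)
  sem-subst v σ (φ ⇒ ψ)  t = cong₂ (λ a b → not a ∨ b) (sem-subst v σ φ t) (sem-subst v σ ψ t)
  sem-subst v σ (□ φ)    t = everywhere-cong (sem-subst v σ φ) t
  sem-subst v σ (◇ φ)    t = cong not (everywhere-cong (λ s → cong not (sem-subst v σ φ s)) t)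

  sem-eval : ∀ v t φ → eval (λ ψ → sem v ψ t) φ ≡ sem v φ t
  sem-eval v t (var x)  = refl
  sem-eval v t ⊥ᶠ       = refl
  sem-eval v t ⊤ᶠ       = refl
  sem-eval v t (φ ∧ᶠ ψ) = cong₂ _∧_ (sem-eval v t φ) (sem-eval v t ψ)
  sem-eval v t (φ ∨ᶠ ψ) = cong₂ _∨_ (sem-eval v t φ) (sem-eval v t ψ)
  sem-eval v t (φ ⇒ ψ)  = cong₂ (λ a b → not a ∨ b) (sem-eval v t φ) (sem-eval v t ψ)
  sem-eval v t (□ φ)    = refl
  sem-eval v t (◇ φ)    = refl

  ≼-trans  : ∀ {r s t} → r ≼ s → s ≼ t → r ≼ t
  ≼-trans* : ∀ {r s ts} → r ≼ s → Any (s ≼_) ts → Any (r ≼_) ts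
  ≼-trans i ≼-refl      = i
  ≼-trans i (≼-child j) = ≼-child (≼-trans* i j)
  ≼-trans* i (here j)  = here (≼-trans i j)
  ≼-trans* i (there j) = there (≼-trans* i j)

  persists : (Tree A → Bool) → Tree A → Bool
  persists f t = not (f t) ∨ everywhere f t

  -- Induction from the leaves: once f holds strictly above t, persists f can
  -- fail at t only if f holds at t.
  grz-valid  : ∀ {f} t → everywhere (λ s → not (everywhere (persists f) s) ∨ f s) t ≡ true →
               everywhere f t ≡ true
  grz-valid* : ∀ {f} ts → everywhere* (λ s → not (everywhere (persists f) s) ∨ f s) ts ≡ true →
               everywhere* f ts ≡ true
  grz-valid {f} (node a ts) e = cong₂ _∧_ root above
    where
    above : everywhere* f ts ≡ true
    above = grz-valid* ts (everywhere-children a ts e)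

    root : f (node a ts) ≡ true
    root with bool? (f (node a ts))
    ... | inj₁ eq = eq
    ... | inj₂ eq = implied (everywhere-root (node a ts) e)
      (cong₂ _∧_ (implies (λ eq′ → contradictory eq′ eq))
                 (everywhere*-intro ts λ {s} i → implies λ _ →
                    everywhere-intro s λ j → everywhere*-elim above (≼-trans* j i)))
  grz-valid* []       e = refl
  grz-valid* (t ∷ ts) e = cong₂ _∧_ (grz-valid t (∧-conicalˡ _ _ e)) (grz-valid* ts (∧-conicalʳ _ _ e))

not-both : ∀ {a b} → a ≡ not b → (not a ∨ (not b ∨ false)) ∧ (not (not b ∨ false) ∨ a) ≡ true
not-both {b = true}  refl = refl
not-both {b = false} refl = refl

soundness : ∀ {φ A} → ⊢ φ → (v : Valuation {A}) (t : Tree A) → sem v φ t ≡ true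
soundness {φ} (taut f) v t = trans (sym (sem-eval v t φ)) (f (λ ψ → sem v ψ t))
soundness {(□ (φ ⇒ ψ) ⇒ (□ φ ⇒ □ ψ))} K v t = implies λ f → implies λ g →
  everywhere-intro t λ i → implied (everywhere-elim f i) (everywhere-elim g i)
soundness {(◇ φ ⇒ ψ) ∧ᶠ _} dual v t =
  not-both (cong not (everywhere-cong (λ s → sym (∨-identityʳ (not (sem v φ s)))) t))
soundness ax v t = implies λ e → everywhere-root t (grz-valid t e)
soundness (mp d e) v t = implied (soundness d v t) (soundness e v t)
soundness (nec d) v t = everywhere-intro t λ {s} _ → soundness d v s
soundness (sub {φ} σ d) v t = trans (sem-subst v σ φ t) (soundness d _ t)

-- Decidable equality of formulas

module _ {A : Set} (_≟ᴬ_ : DecidableEquality A) where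

  tree-≟  : DecidableEquality (Tree A)
  trees-≟ : DecidableEquality (List (Tree A))
  tree-≟ (node a ts) (node b us) =
    map′ (λ (x , y) → cong₂ node x y) (λ { refl → refl , refl }) (a ≟ᴬ b ×-dec trees-≟ ts us)
  trees-≟ []       []       = yes refl
  trees-≟ []       (_ ∷ _)  = no λ ()
  trees-≟ (_ ∷ _)  []       = no λ ()
  trees-≟ (t ∷ ts) (u ∷ us) =
    map′ (λ (x , y) → cong₂ _∷_ x y) (λ { refl → refl , refl }) (tree-≟ t u ×-dec trees-≟ ts us)

-- Equality is pulled back along an encoding with a left inverse, which avoids comparing all pairs
-- of constructors. The number of children and the label together identify the connective; the
-- leaves 0 and 1 are the constants, so variables start at 2.
encode : Fm → Tree ℕ
encode (var x)  = node (2 + x) []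
encode ⊥ᶠ       = node 0 []
encode ⊤ᶠ       = node 1 []
encode (φ ∧ᶠ ψ) = node 0 (encode φ ∷ encode ψ ∷ [])
encode (φ ∨ᶠ ψ) = node 1 (encode φ ∷ encode ψ ∷ [])
encode (φ ⇒ ψ)  = node 2 (encode φ ∷ encode ψ ∷ [])
encode (□ φ)    = node 0 (encode φ ∷ [])
encode (◇ φ)    = node 1 (encode φ ∷ [])

-- ⊤ᶠ is a junk value on trees that encode no formula.
decode : Tree ℕ → Fm
decode (node 0 [])                = ⊥ᶠ
decode (node (suc (suc x)) [])    = var x
decode (node 0 (s ∷ []))          = □ decode s
decode (node 1 (s ∷ []))          = ◇ decode s
decode (node 0 (s ∷ t ∷ []))      = decode s ∧ᶠ decode t
decode (node 1 (s ∷ t ∷ []))      = decode s ∨ᶠ decode t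
decode (node 2 (s ∷ t ∷ []))      = decode s ⇒ decode t
decode _                          = ⊤ᶠ

decode-encode : ∀ φ → decode (encode φ) ≡ φ
decode-encode (var x)  = refl
decode-encode ⊥ᶠ       = refl
decode-encode ⊤ᶠ       = refl
decode-encode (φ ∧ᶠ ψ) = cong₂ _∧ᶠ_ (decode-encode φ) (decode-encode ψ)
decode-encode (φ ∨ᶠ ψ) = cong₂ _∨ᶠ_ (decode-encode φ) (decode-encode ψ)
decode-encode (φ ⇒ ψ)  = cong₂ _⇒_ (decode-encode φ) (decode-encode ψ)
decode-encode (□ φ)    = cong □_ (decode-encode φ)
decode-encode (◇ φ)    = cong ◇_ (decode-encode φ)

_≟ᶠ_ : DecidableEquality Fm
φ ≟ᶠ ψ = map′ (λ e → trans (sym (decode-encode φ)) (trans (cong decode e) (decode-encode ψ)))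
              (cong encode) (tree-≟ _≟_ (encode φ) (encode ψ))

-- Completeness for finite trees

Model : Set
Model = Tree (Var → Bool)

⟦_⟧ : Fm → Model → Bool
⟦_⟧ = sem label

-- Worlds and derivation by exhaustive case distinction

World : Set
World = Fm → Bool

literal : Bool → Fm → Fm
literal true  φ = φ
literal false φ = ¬ᶠ φ

literal-sound : ∀ {v φ} b → v ⊨ literal b φ → eval v φ ≡ b
literal-sound true  (holds e) = e
literal-sound {v} {φ} false (holds e) with eval v φ
... | false = refl

literal-complete : ∀ {v φ} b → eval v φ ≡ b → v ⊨ literal b φ
literal-complete true  e = holds e
literal-complete {φ = φ} false e = ⊨¬ φ e

description : World → List Fm → Fm
description w []      = ⊤ᶠ
description w (φ ∷ L) = literal (w φ) φ ∧ᶠ description w L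

description-sound : ∀ {v} w L → v ⊨ description w L → All (λ φ → eval v φ ≡ w φ) L
description-sound w []      h = []
description-sound w (φ ∷ L) h = literal-sound (w φ) (∧-elimˡ h) ∷ description-sound w L (∧-elimʳ h)

description-complete : ∀ {v} w L → All (λ φ → eval v φ ≡ w φ) L → v ⊨ description w L
description-complete w []      []       = holds refl
description-complete w (φ ∷ L) (e ∷ es) =
  ∧-intro (literal-complete (w φ) e) (description-complete w L es)

update : World → Fm → Bool → World
update w φ b ψ with ψ ≟ᶠ φ
... | yes _ = b
... | no _  = w ψ

update-agrees : ∀ {v} w φ b {ψ} → eval v φ ≡ b → eval v ψ ≡ w ψ → eval v ψ ≡ update w φ b ψ
update-agrees w φ b {ψ} e e′ with ψ ≟ᶠ φ
... | yes refl = e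
... | no _     = e′

update-same : ∀ w φ b → update w φ b φ ≡ b
update-same w φ b with φ ≟ᶠ φ
... | yes _ = refl
... | no ne = ⊥-elim (ne refl)

-- This replaces Lindenbaum's lemma. The formulas of `L` are decided one after another: if both
-- branches at `φ` derive `θ`, excluded middle inside the logic merges them; otherwise some branch
-- has produced a world with `P`.
worlds : ∀ {P : World → Set} L θ → (∀ w → (⊢ description w L ⇒ θ) ⊎ P w) → (⊢ θ) ⊎ ∃ P
-- The enclosing branches set the decided formulas through `update`; all others keep the default
-- `false`.
worlds [] θ search with search (λ _ → false)
... | inj₁ d = inj₁ (infer₁ (λ v f → ⇒-elim f (holds refl)) d)
... | inj₂ p = inj₂ (_ , p)
worlds {P} (φ ∷ L) θ search = combine (branch true) (branch false)
  where
  branch : ∀ b → (⊢ literal b φ ⇒ θ) ⊎ ∃ P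
  branch b = flatten (worlds L _ λ w → extend w (search (update w φ b)))
    where
    flatten : ∀ {X : Set} → X ⊎ World × ∃ P → X ⊎ ∃ P
    flatten (inj₁ d)       = inj₁ d
    flatten (inj₂ (_ , p)) = inj₂ p

    extend : ∀ w → (⊢ description (update w φ b) (φ ∷ L) ⇒ θ) ⊎ P (update w φ b) →
             (⊢ description w L ⇒ literal b φ ⇒ θ) ⊎ ∃ P
    extend w (inj₂ p) = inj₂ (_ , p)
    extend w (inj₁ d) = inj₁ (infer₁ (λ v f → ⇒-intro λ h → ⇒-intro λ l →
      let e = literal-sound b l in
      ⇒-elim f (description-complete (update w φ b) (φ ∷ L)
        (trans e (sym (update-same w φ b))
          ∷ All.map (update-agrees w φ b e) (description-sound w L h)))) d)

  combine : (⊢ φ ⇒ θ) ⊎ ∃ P → (⊢ ¬ᶠ φ ⇒ θ) ⊎ ∃ P → (⊢ θ) ⊎ ∃ P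
  combine (inj₂ p) _        = inj₂ p
  combine (inj₁ _) (inj₂ p) = inj₂ p
  combine (inj₁ d) (inj₁ e) = inj₁ (infer₂ (λ v f g → by-cases φ (⇒-elim f) (⇒-elim g)) d e)

-- For `◇ φ` the formula `□ ¬ᶠ φ` is included, because the truth of a diamond is reduced by duality
-- to that of a box.
Components : List Fm → Fm → Set
Components S (var x)  = ⊤
Components S ⊥ᶠ       = ⊤
Components S ⊤ᶠ       = ⊤
Components S (φ ∧ᶠ ψ) = φ ∈ S × ψ ∈ S
Components S (φ ∨ᶠ ψ) = φ ∈ S × ψ ∈ S
Components S (φ ⇒ ψ)  = φ ∈ S × ψ ∈ S
Components S (□ φ)    = φ ∈ S
Components S (◇ φ)    = φ ∈ S × (□ ¬ᶠ φ) ∈ S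

-- Relative to a finite set S closed under components, a world is a valuation
-- of the atoms (variables and modal formulas) of S.  As in Boolos' completeness
-- proof for Grz, the atoms □ (φ ⇒ □ φ) are added: passing from a world where
-- φ holds and □ φ fails to one where φ fails, one may require □ (φ ⇒ □ φ) to
-- become true, so that the number of false boxes decreases.
module Search (S : List Fm) (closed : All (Components S) S) where

  components : ∀ {φ} → φ ∈ S → Components S φ
  components = All.lookup closed

  boxedIn : Fm → List Fm
  boxedIn (□ φ) = φ ∷ (φ ⇒ □ φ) ∷ []
  boxedIn _     = []

  unboxedAtoms : Fm → List Fm
  unboxedAtoms (var x) = var x ∷ []
  unboxedAtoms (◇ φ)   = ◇ φ ∷ []
  unboxedAtoms _       = []

  boxed : List Fm
  boxed = concatMap boxedIn S

  atoms : List Fm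
  atoms = map □_ boxed ++ concatMap unboxedAtoms S

  boxed∈ : ∀ {φ ψ} → ψ ∈ S → φ ∈ boxedIn ψ → φ ∈ boxed
  boxed∈ i j = ∈-concatMap⁺ boxedIn (Any.map (λ { refl → j }) i)

  box∈ : ∀ {φ} → φ ∈ boxed → (□ φ) ∈ atoms
  box∈ i = ∈-++⁺ˡ (∈-map⁺ □_ i)

  unboxed∈ : ∀ {φ ψ} → ψ ∈ S → φ ∈ unboxedAtoms ψ → φ ∈ atoms
  unboxed∈ i j = ∈-++⁺ʳ (map □_ boxed) (∈-concatMap⁺ unboxedAtoms (Any.map (λ { refl → j }) i))

  infix 4 _≈_
  _≈_ : World → World → Set
  v ≈ w = All (λ φ → eval v φ ≡ w φ) atoms

  eval-cong : ∀ {v w} → v ≈ w → ∀ φ → φ ∈ S → eval v φ ≡ eval w φ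
  eval-cong h (var x)  i = All.lookup h (unboxed∈ i (here refl))
  eval-cong h ⊥ᶠ       i = refl
  eval-cong h ⊤ᶠ       i = refl
  eval-cong h (φ ∧ᶠ ψ) i = let j , k = components i in cong₂ _∧_ (eval-cong h φ j) (eval-cong h ψ k)
  eval-cong h (φ ∨ᶠ ψ) i = let j , k = components i in cong₂ _∨_ (eval-cong h φ j) (eval-cong h ψ k)
  eval-cong h (φ ⇒ ψ)  i =
    let j , k = components i in cong₂ (λ a b → not a ∨ b) (eval-cong h φ j) (eval-cong h ψ k)
  eval-cong h (□ φ)    i = All.lookup h (box∈ (boxed∈ i (here refl)))
  eval-cong h (◇ φ)    i = All.lookup h (unboxed∈ i (here refl))

  boxes : World → List Fm → Fm
  boxes w []      = ⊤ᶠ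
  boxes w (φ ∷ L) = (if w (□ φ) then □ φ else ⊤ᶠ) ∧ᶠ boxes w L

  boxes-self : ∀ w L → eval w (boxes w L) ≡ true
  boxes-self w []      = refl
  boxes-self w (φ ∷ L) with w (□ φ) in e
  ... | true  = cong₂ _∧_ e (boxes-self w L)
  ... | false = boxes-self w L

  boxes-cong : ∀ {v x} → v ≈ x → ∀ w L → L ⊆ boxed → eval v (boxes w L) ≡ eval x (boxes w L)
  boxes-cong h w []      inc = refl
  boxes-cong h w (φ ∷ L) inc with w (□ φ)
  ... | true  = cong₂ _∧_ (All.lookup h (box∈ (inc (here refl)))) (boxes-cong h w L (inc ∘ there))
  ... | false = boxes-cong h w L (inc ∘ there)

  boxes-elim : ∀ {x} w L → x ⊨ boxes w L → ∀ {φ} → φ ∈ L → w (□ φ) ≡ true → x (□ φ) ≡ true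
  boxes-elim w (φ ∷ L) h (here refl) e with w (□ φ)
  boxes-elim w (φ ∷ L) h (here refl) refl | true = truth (∧-elimˡ h)
  boxes-elim w (φ ∷ L) h (there i)   e = boxes-elim w L (∧-elimʳ h) i e

  -- Each conjunct is `⊤ᶠ` or a box, hence persistent by `transitivity`, and `□` distributes over
  -- conjunction.
  boxes-□ : ∀ w L → ⊢ boxes w L ⇒ □ boxes w L
  boxes-□ w []      = infer₁ (λ v h → ⇒-intro λ _ → h) (nec (infer₀ λ v → holds refl))
  boxes-□ w (φ ∷ L) = infer₂ (λ v f g → ⇒-intro λ h →
                        ⇒-elim (⇒-elim g (⇒-elim f (∧-elimˡ h))) (∧-elimʳ h)) □-head □-both
    where
    head = if w (□ φ) then □ φ else ⊤ᶠ

    □-head : ⊢ head ⇒ □ head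
    □-head with w (□ φ)
    ... | true  = transitivity φ
    ... | false = infer₁ (λ v h → ⇒-intro λ _ → h) (nec (infer₀ λ v → holds refl))

    □-both : ⊢ □ head ⇒ boxes w L ⇒ □ (head ∧ᶠ boxes w L)
    □-both = infer₂ (λ v f g → ⇒-intro λ x → ⇒-intro λ y → ⇒-elim (⇒-elim f x) (⇒-elim g y))
               (⇒-trans (□-mono (infer₀ λ v → ⇒-intro λ x → ⇒-intro λ y → ∧-intro x y)) K)
               (boxes-□ w L)

  deficit : World → List Fm → ℕ
  deficit w []      = 0
  deficit w (φ ∷ L) = (if w (□ φ) then 0 else 1) + deficit w L

  module _ {w x : World} where

    bit-≤ : ∀ a b → (a ≡ true → b ≡ true) → (if b then 0 else 1) ≤ (if a then 0 else 1)
    bit-≤ true  b     h rewrite h refl = z≤n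
    bit-≤ false true  h = z≤n
    bit-≤ false false h = s≤s z≤n

    deficit-≤ : ∀ L → (∀ {φ} → φ ∈ L → w (□ φ) ≡ true → x (□ φ) ≡ true) →
                deficit x L ≤ deficit w L
    deficit-≤ []      h = z≤n
    deficit-≤ (φ ∷ L) h = +-mono-≤ (bit-≤ _ _ (h (here refl))) (deficit-≤ L (h ∘ there))

    deficit-< : ∀ L → (∀ {φ} → φ ∈ L → w (□ φ) ≡ true → x (□ φ) ≡ true) →
                ∀ {φ} → φ ∈ L → w (□ φ) ≡ false → x (□ φ) ≡ true → deficit x L < deficit w L
    deficit-< (φ ∷ L) h (here refl) e e′ rewrite e | e′ = s≤s (deficit-≤ L (h ∘ there))
    deficit-< (φ ∷ L) h (there i)   e e′ =
      +-mono-≤-< (bit-≤ _ _ (h (here refl))) (deficit-< L (h ∘ there) i e e′)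

  Refuted : World → Set
  Refuted w = ⊢ ¬ᶠ description w atoms

  -- The tree answers for `S` alone; the added atoms `□ (φ ⇒ □ φ)` steer the search for it.
  Realised : World → Set
  Realised w = Σ[ t ∈ Model ] (∀ φ → φ ∈ S → ⟦ φ ⟧ t ≡ eval w φ)

  Preserves : World → Model → Set
  Preserves w t = ∀ {φ} → (□ φ) ∈ S → w (□ φ) ≡ true → ⟦ □ φ ⟧ t ≡ true

  -- The local condition that the truth lemma asks for at one formula. By reflexivity `w` itself may
  -- witness that a box is false, and then no child is called for.
  Coherent : World → List Model → Fm → Set
  Coherent w ts (□ φ) = (w (□ φ) ≡ true × eval w φ ≡ true)
                      ⊎ (w (□ φ) ≡ false × (eval w φ ≡ false ⊎ Any (λ t → ⟦ φ ⟧ t ≡ false) ts))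
  Coherent w ts (◇ φ) = w (◇ φ) ≡ not (w (□ ¬ᶠ φ))
  Coherent w ts _     = ⊤

  record Status (w : World) (φ : Fm) : Set where
    constructor status
    field
      kids      : List Model
      preserved : All (Preserves w) kids
      coherent  : Coherent w kids φ
  open Status

  -- A world is inconsistent as soon as one theorem fails in it, provided that the atoms determine
  -- the value of this theorem: the description of the world then derives its negation.
  refute : ∀ {w} θ → ⊢ θ → (∀ {v} → v ≈ w → eval v θ ≡ eval w θ) → eval w θ ≡ false → Refuted w
  refute {w} θ d same e = infer₁ (λ v t → ⇒-intro λ h →
    ⇒-elim (⊨¬ θ (trans (same (description-sound w atoms h)) e)) t) d

  module Truth {w : World} (statuses : All (Status w) S) where

    allKids : ∀ {T} → All (Status w) T → List Model
    allKids []       = []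
    allKids (s ∷ ss) = kids s ++ allKids ss

    allPreserved : ∀ {T} (ss : All (Status w) T) → All (Preserves w) (allKids ss)
    allPreserved []       = []
    allPreserved (s ∷ ss) = All.++⁺ (preserved s) (allPreserved ss)

    allKids-any : ∀ {T φ} {P : Model → Set} (ss : All (Status w) T) (i : φ ∈ T) →
                  Any P (kids (All.lookup ss i)) → Any P (allKids ss)
    allKids-any (s ∷ ss) (here refl) a = Any.++⁺ˡ a
    allKids-any (s ∷ ss) (there i)   a = Any.++⁺ʳ (kids s) (allKids-any ss i a)

    -- The children gathered for different boxes can stand side by side, since each of them
    -- preserves all true boxes of `w` that lie in `S`.
    model : Model
    model = node (λ x → w (var x)) (allKids statuses)

    everywhere*-true : ∀ {φ ts} → (□ φ) ∈ S → w (□ φ) ≡ true → All (Preserves w) ts →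
                       everywhere* ⟦ φ ⟧ ts ≡ true
    everywhere*-true i e []       = refl
    everywhere*-true i e (h ∷ hs) = cong₂ _∧_ (h i e) (everywhere*-true i e hs)

    box-truth : ∀ φ → (□ φ) ∈ S → ⟦ φ ⟧ model ≡ eval w φ → ⟦ □ φ ⟧ model ≡ w (□ φ)
    box-truth φ i e with coherent (All.lookup statuses i)
    ... | inj₁ (b , e′) = trans (cong₂ _∧_ (trans e e′) (everywhere*-true i b (allPreserved statuses))) (sym b)
    ... | inj₂ (b , inj₁ e′) = trans (cong (_∧ everywhere* ⟦ φ ⟧ (allKids statuses)) (trans e e′)) (sym b)
    ... | inj₂ (b , inj₂ a) = trans (¬-not λ h → refuted-by (allKids-any statuses i a)
                                (everywhere-children {f = ⟦ φ ⟧} (λ x → w (var x)) (allKids statuses) h)) (sym b)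
      where
      refuted-by : ∀ {ts} → Any (λ t → ⟦ φ ⟧ t ≡ false) ts → everywhere* ⟦ φ ⟧ ts ≡ true → ⊥
      refuted-by (here {x = t} f) h = contradictory (everywhere-root t (∧-conicalˡ _ _ h)) f
      refuted-by (there {x = t} j) h = refuted-by j (∧-conicalʳ (everywhere ⟦ φ ⟧ t) _ h)

    truth-lemma : ∀ φ → φ ∈ S → ⟦ φ ⟧ model ≡ eval w φ
    truth-lemma (var x)  i = refl
    truth-lemma ⊥ᶠ       i = refl
    truth-lemma ⊤ᶠ       i = refl
    truth-lemma (φ ∧ᶠ ψ) i = let j , k = components i in cong₂ _∧_ (truth-lemma φ j) (truth-lemma ψ k)
    truth-lemma (φ ∨ᶠ ψ) i = let j , k = components i in cong₂ _∨_ (truth-lemma φ j) (truth-lemma ψ k)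
    truth-lemma (φ ⇒ ψ)  i = let j , k = components i in cong₂ (λ a b → not a ∨ b) (truth-lemma φ j) (truth-lemma ψ k)
    truth-lemma (□ φ)    i = box-truth φ i (truth-lemma φ (components i))
    truth-lemma (◇ φ)    i = let j , k = components i in
      trans (cong not (trans (everywhere-cong (λ s → sym (∨-identityʳ (not (⟦ φ ⟧ s)))) model)
                             (box-truth (¬ᶠ φ) k (cong (λ a → not a ∨ false) (truth-lemma φ j)))))
            (sym (coherent (All.lookup statuses i)))

  module Step {w : World} (descend : ∀ x → deficit x boxed < deficit w boxed → Refuted x ⊎ Realised x) where

    module _ φ (i : (□ φ) ∈ S) (□φ-false : w (□ φ) ≡ false) (φ-true : eval w φ ≡ true)
             (□persist-false : w (□ (φ ⇒ □ φ)) ≡ false) where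

      goal : Fm
      goal = boxes w boxed ∧ᶠ (□ (φ ⇒ □ φ) ∧ᶠ ¬ᶠ φ)

      persist∈ : (φ ⇒ □ φ) ∈ boxed
      persist∈ = boxed∈ i (there (here refl))

      goal-cong : ∀ {v x} → v ≈ x → eval v goal ≡ eval x goal
      goal-cong h = cong₂ _∧_ (boxes-cong h w boxed id)
        (cong₂ _∧_ (All.lookup h (box∈ persist∈))
                   (cong (λ a → not a ∨ false) (eval-cong h φ (components i))))

      Kid : World → Set
      Kid x = x ⊨ goal × Realised x

      candidate : ∀ x → (⊢ description x atoms ⇒ ¬ᶠ goal) ⊎ Kid x
      candidate x with bool? (eval x goal)
      ... | inj₂ e = inj₁ (infer₀ λ v → ⇒-intro λ h →
                       ⊨¬ goal (trans (goal-cong (description-sound x atoms h)) e))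
      ... | inj₁ e with descend x (deficit-< {w} {x} boxed (boxes-elim w boxed (∧-elimˡ g)) persist∈ □persist-false
                                     (truth (∧-elimˡ (∧-elimʳ g))))
        where
        g : x ⊨ goal
        g = holds e
      ...   | inj₁ d = inj₁ (infer₁ (λ v n → ⇒-intro λ h → ⊥-elimᶠ (⇒-elim n h)) d)
      ...   | inj₂ r = inj₂ (holds e , r)

      -- Here the Grzegorczyk axiom enters. If `goal` is refutable, the true boxes of `w` derive
      -- `□ (φ ⇒ □ φ) ⇒ φ`; being persistent, they derive the box of it and thus `□ φ`. As `□ φ` is
      -- false at `w`, this refutes `w`.
      boxes⇒□ : ⊢ ¬ᶠ goal → ⊢ boxes w boxed ⇒ □ φ
      boxes⇒□ d = ⇒-trans (boxes-□ w boxed) (⇒-trans (□-mono (infer₁ (λ v n →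
        ⇒-intro λ b → ⇒-intro λ p → by-cases φ id λ ¬φ →
          ⊥-elimᶠ (⇒-elim n (∧-intro b (∧-intro p ¬φ)))) d)) (grz-□ φ))

      kid-status : Refuted w ⊎ Status w (□ φ)
      kid-status with worlds atoms (¬ᶠ goal) candidate
      ... | inj₁ d = inj₁ (refute (boxes w boxed ⇒ □ φ) (boxes⇒□ d)
              (λ h → cong₂ (λ a b → not a ∨ b) (boxes-cong h w boxed id) (eval-cong h (□ φ) i))
              (cong₂ (λ a b → not a ∨ b) (boxes-self w boxed) □φ-false))
      ... | inj₂ (x , g , t , real) = inj₂ (status (t ∷ [])
              ((λ {ψ} j e → trans (real (□ ψ) j)
                  (boxes-elim w boxed (∧-elimˡ g) (boxed∈ j (here refl)) e)) ∷ [])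
              (inj₂ (□φ-false , inj₂ (here (trans (real φ (components i))
                  (literal-sound false (∧-elimʳ (∧-elimʳ g))))))))

    box-status : ∀ φ → (□ φ) ∈ S → Refuted w ⊎ Status w (□ φ)
    box-status φ i with bool? (w (□ φ)) | bool? (eval w φ) | bool? (w (□ (φ ⇒ □ φ)))
    ... | inj₁ b | inj₁ e | _ = inj₂ (status [] [] (inj₁ (b , e)))
    ... | inj₁ b | inj₂ e | _ = inj₁ (refute (□ φ ⇒ φ) (reflexivity φ)
            (λ h → cong₂ (λ a b → not a ∨ b) (eval-cong h (□ φ) i) (eval-cong h φ (components i)))
            (cong₂ (λ a b → not a ∨ b) b e))
    ... | inj₂ b | inj₂ e | _ = inj₂ (status [] [] (inj₂ (b , inj₁ e)))
    ... | inj₂ b | inj₁ e | inj₂ f = kid-status φ i b e f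
    -- Reflexivity for the added atom excludes this case, so whenever a child is sought the atom is
    -- false at `w` and making it true lowers the deficit.
    ... | inj₂ b | inj₁ e | inj₁ f = inj₁ (refute (□ (φ ⇒ □ φ) ⇒ φ ⇒ □ φ) (reflexivity _)
            (λ h → cong₂ (λ a b → not a ∨ b) (All.lookup h (box∈ (boxed∈ i (there (here refl)))))
                     (cong₂ (λ a b → not a ∨ b) (eval-cong h φ (components i)) (eval-cong h (□ φ) i)))
            (cong₂ (λ a b → not a ∨ b) f (cong₂ (λ a b → not a ∨ b) e b)))

    diamond-status : ∀ φ → (◇ φ) ∈ S → Refuted w ⊎ Status w (◇ φ)
    diamond-status φ i with bool? (eval w (◇ φ ⇔ᶠ ¬ᶠ □ ¬ᶠ φ))
    ... | inj₁ e = inj₂ (status [] [] (dual-holds (w (◇ φ)) (w (□ ¬ᶠ φ)) e))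
      where
      dual-holds : ∀ a b → (not a ∨ (not b ∨ false)) ∧ (not (not b ∨ false) ∨ a) ≡ true → a ≡ not b
      dual-holds true  false e = refl
      dual-holds false true  e = refl
    ... | inj₂ e = inj₁ (refute (◇ φ ⇔ᶠ ¬ᶠ □ ¬ᶠ φ) dual
            (λ h → cong₂ (λ a b → (not a ∨ (not b ∨ false)) ∧ (not (not b ∨ false) ∨ a))
                     (eval-cong h (◇ φ) i) (eval-cong h (□ ¬ᶠ φ) (proj₂ (components i)))) e)

    decide-status : ∀ φ → φ ∈ S → Refuted w ⊎ Status w φ
    decide-status (var x)  i = inj₂ (status [] [] tt)
    decide-status ⊥ᶠ       i = inj₂ (status [] [] tt)
    decide-status ⊤ᶠ       i = inj₂ (status [] [] tt)
    decide-status (_ ∧ᶠ _) i = inj₂ (status [] [] tt)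
    decide-status (_ ∨ᶠ _) i = inj₂ (status [] [] tt)
    decide-status (_ ⇒ _)  i = inj₂ (status [] [] tt)
    decide-status (□ φ)    i = box-status φ i
    decide-status (◇ φ)    i = diamond-status φ i

    decide-all : ∀ T → T ⊆ S → Refuted w ⊎ All (Status w) T
    decide-all []      inc = inj₂ []
    decide-all (φ ∷ T) inc with decide-status φ (inc (here refl)) | decide-all T (inc ∘ there)
    ... | inj₁ d | _       = inj₁ d
    ... | inj₂ s | inj₁ d  = inj₁ d
    ... | inj₂ s | inj₂ ss = inj₂ (s ∷ ss)

    decide : Refuted w ⊎ Realised w
    decide with decide-all S id
    ... | inj₁ d  = inj₁ d
    ... | inj₂ ss = inj₂ (Truth.model ss , Truth.truth-lemma ss)

  -- The fuel `n` strictly bounds the deficit and makes the descent structural.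
  search : ∀ n w → deficit w boxed < n → Refuted w ⊎ Realised w
  search (suc n) w (s≤s le) = Step.decide {w} λ x lt → search n x (<-≤-trans lt le)

  provable-or-refutable : ∀ φ → φ ∈ S → (⊢ φ) ⊎ Σ[ t ∈ Model ] ⟦ φ ⟧ t ≡ false
  provable-or-refutable φ i with worlds {λ w → eval w φ ≡ false × Realised w} atoms φ candidate
    where
    candidate : ∀ w → (⊢ description w atoms ⇒ φ) ⊎ (eval w φ ≡ false × Realised w)
    candidate w with bool? (eval w φ)
    ... | inj₁ e = inj₁ (infer₀ λ v → ⇒-intro λ h →
                     holds (trans (eval-cong (description-sound w atoms h) φ i) e))
    ... | inj₂ e with search _ w ≤-refl
    ...   | inj₁ d = inj₁ (infer₁ (λ v n → ⇒-intro λ h → ⊥-elimᶠ (⇒-elim n h)) d)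
    ...   | inj₂ r = inj₂ (e , r)
  ... | inj₁ d = inj₁ d
  ... | inj₂ (w , e , t , real) = inj₂ (t , trans (real φ i) e)

-- Finite sets closed under components

subformulas : Fm → List Fm
subformulas (var x)  = var x ∷ []
subformulas ⊥ᶠ       = ⊥ᶠ ∷ []
subformulas ⊤ᶠ       = ⊤ᶠ ∷ []
subformulas (φ ∧ᶠ ψ) = (φ ∧ᶠ ψ) ∷ subformulas φ ++ subformulas ψ
subformulas (φ ∨ᶠ ψ) = (φ ∨ᶠ ψ) ∷ subformulas φ ++ subformulas ψ
subformulas (φ ⇒ ψ)  = (φ ⇒ ψ) ∷ subformulas φ ++ subformulas ψ
subformulas (□ φ)    = □ φ ∷ subformulas φ
-- `□ ¬ᶠ φ` is a component of `◇ φ` and brings in `¬ᶠ φ`, which brings in `⊥ᶠ`.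
subformulas (◇ φ)    = ◇ φ ∷ □ ¬ᶠ φ ∷ ¬ᶠ φ ∷ ⊥ᶠ ∷ subformulas φ

self∈subformulas : ∀ φ → φ ∈ subformulas φ
self∈subformulas (var x)  = here refl
self∈subformulas ⊥ᶠ       = here refl
self∈subformulas ⊤ᶠ       = here refl
self∈subformulas (φ ∧ᶠ ψ) = here refl
self∈subformulas (φ ∨ᶠ ψ) = here refl
self∈subformulas (φ ⇒ ψ)  = here refl
self∈subformulas (□ φ)    = here refl
self∈subformulas (◇ φ)    = here refl

components-mono : ∀ {S T} → S ⊆ T → ∀ φ → Components S φ → Components T φ
components-mono inc (var x)  c       = tt
components-mono inc ⊥ᶠ       c       = tt
components-mono inc ⊤ᶠ       c       = tt
components-mono inc (φ ∧ᶠ ψ) (i , j) = inc i , inc j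
components-mono inc (φ ∨ᶠ ψ) (i , j) = inc i , inc j
components-mono inc (φ ⇒ ψ)  (i , j) = inc i , inc j
components-mono inc (□ φ)    i       = inc i
components-mono inc (◇ φ)    (i , j) = inc i , inc j

subformulas-closed : ∀ φ → All (Components (subformulas φ)) (subformulas φ)
closed-weaken : ∀ {T} φ → subformulas φ ⊆ T → All (Components T) (subformulas φ)
closed-weaken φ inc = All.map (components-mono inc _) (subformulas-closed φ)

module _ (φ ψ : Fm) where

  private
    L = subformulas φ ++ subformulas ψ

  binary-components : ∀ {χ} → φ ∈ χ ∷ L × ψ ∈ χ ∷ L
  binary-components = there (∈-++⁺ˡ (self∈subformulas φ))
                    , there (∈-++⁺ʳ (subformulas φ) (self∈subformulas ψ))

  binary-closed : ∀ {χ} → All (Components (χ ∷ L)) L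
  binary-closed = All.++⁺ (closed-weaken φ (there ∘ ∈-++⁺ˡ))
                          (closed-weaken ψ (there ∘ ∈-++⁺ʳ (subformulas φ)))

subformulas-closed (var x)  = tt ∷ []
subformulas-closed ⊥ᶠ       = tt ∷ []
subformulas-closed ⊤ᶠ       = tt ∷ []
subformulas-closed (φ ∧ᶠ ψ) = binary-components φ ψ ∷ binary-closed φ ψ
subformulas-closed (φ ∨ᶠ ψ) = binary-components φ ψ ∷ binary-closed φ ψ
subformulas-closed (φ ⇒ ψ)  = binary-components φ ψ ∷ binary-closed φ ψ
subformulas-closed (□ φ)    = there (self∈subformulas φ) ∷ closed-weaken φ there
subformulas-closed (◇ φ)    = (self , there (here refl)) ∷ there (there (here refl))
                            ∷ (self , there (there (there (here refl)))) ∷ tt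
                            ∷ closed-weaken φ (there ∘ there ∘ there ∘ there)
  where
  self = there (there (there (there (self∈subformulas φ))))

completeness : ∀ {φ} → (∀ t → ⟦ φ ⟧ t ≡ true) → ⊢ φ
completeness {φ} valid
  with Search.provable-or-refutable (subformulas φ) (subformulas-closed φ) φ (self∈subformulas φ)
... | inj₁ d       = d
... | inj₂ (t , e) = contradictory (valid t) e

-- One-variable formulas on trees with marked nodes

-- All variables read the mark, so that `value` does not depend on which `p` a formula in `Fm(p)`
-- uses.
value : Fm → Tree Bool → Bool
value = sem λ t _ → label t

if-self : ∀ {X : Set} x (a b : X) → (if does (x ≟ x) then a else b) ≡ a
if-self x a b = cong (λ c → if c then a else b) (dec-true (x ≟ x) refl)

if-other : ∀ {X : Set} {x y} (a b : X) → x ≢ y → (if does (y ≟ x) then a else b) ≡ b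
if-other {x = x} {y} a b ne = cong (λ c → if c then a else b) (dec-false (y ≟ x) (ne ∘ sym))

module _ {A : Set} where

  mark  : (Tree A → Bool) → Tree A → Tree Bool
  mark* : (Tree A → Bool) → List (Tree A) → List (Tree Bool)
  mark P (node a ts) = node (P (node a ts)) (mark* P ts)
  mark* P []       = []
  mark* P (t ∷ ts) = mark P t ∷ mark* P ts

  everywhere-mark  : ∀ {P f g} → (∀ t → f t ≡ g (mark P t)) → ∀ t → everywhere f t ≡ everywhere g (mark P t)
  everywhere*-mark : ∀ {P f g} → (∀ t → f t ≡ g (mark P t)) → ∀ ts → everywhere* f ts ≡ everywhere* g (mark* P ts)
  everywhere-mark h (node a ts) = cong₂ _∧_ (h (node a ts)) (everywhere*-mark h ts)
  everywhere*-mark h []       = refl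
  everywhere*-mark h (t ∷ ts) = cong₂ _∧_ (everywhere-mark h t) (everywhere*-mark h ts)

  sem-mark : ∀ {p v P} φ → φ ∈Fm p → (∀ t → v t p ≡ P t) → ∀ t → sem v φ t ≡ value φ (mark P t)
  sem-mark (var x)  refl    h (node a ts) = h (node a ts)
  sem-mark ⊥ᶠ       _       h t = refl
  sem-mark ⊤ᶠ       _       h t = refl
  sem-mark (φ ∧ᶠ ψ) (i , j) h t = cong₂ _∧_ (sem-mark φ i h t) (sem-mark ψ j h t)
  sem-mark (φ ∨ᶠ ψ) (i , j) h t = cong₂ _∨_ (sem-mark φ i h t) (sem-mark ψ j h t)
  sem-mark (φ ⇒ ψ)  (i , j) h t = cong₂ (λ a b → not a ∨ b) (sem-mark φ i h t) (sem-mark ψ j h t)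
  sem-mark (□ φ)    i       h t = everywhere-mark (sem-mark φ i h) t
  sem-mark (◇ φ)    i       h t = cong not (everywhere-mark (λ s → cong not (sem-mark φ i h s)) t)

  sem-instance : ∀ {p v P} φ ψ → φ ∈Fm p → (∀ t → sem v ψ t ≡ P t) →
                 ∀ t → sem v (φ [ p ≔ ψ ]) t ≡ value φ (mark P t)
  sem-instance {p} {v} φ ψ i h t =
    trans (sem-subst v _ φ t) (sem-mark φ i (λ s → trans (cong (λ χ → sem v χ s) (if-self p ψ (var p))) (h s)) t)

⇔-sound : ∀ {φ ψ A} → Equivalent Grz φ ψ → (v : Valuation {A}) (t : Tree A) → sem v φ t ≡ sem v ψ t
⇔-sound {φ} {ψ} d v t = let e = soundness d v t in
  ≡-by-truth (implied (∧-conicalˡ _ _ e)) (implied (∧-conicalʳ (not (sem v φ t) ∨ sem v ψ t) _ e))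

⇔-complete : ∀ {φ ψ} → (∀ t → ⟦ φ ⟧ t ≡ ⟦ ψ ⟧ t) → Equivalent Grz φ ψ
⇔-complete h = completeness λ t → cong₂ _∧_ (implies λ e → trans (sym (h t)) e) (implies λ e → trans (h t) e)

value-complete : ∀ {p} φ ψ → φ ∈Fm p → ψ ∈Fm p → (∀ t → value φ t ≡ value ψ t) → Equivalent Grz φ ψ
value-complete φ ψ i j h = ⇔-complete λ t →
  trans (sem-mark φ i (λ _ → refl) t) (trans (h _) (sym (sem-mark ψ j (λ _ → refl) t)))

-- Additivity

-- A relation rather than an operation, since marks can be united only on a common underlying tree.
mutual
  data Join : Tree Bool → Tree Bool → Tree Bool → Set where
    join : ∀ {a b c ts us ss} → c ≡ a ∨ b → Join* ts us ss → Join (node a ts) (node b us) (node c ss)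

  data Join* : List (Tree Bool) → List (Tree Bool) → List (Tree Bool) → Set where
    []  : Join* [] [] []
    _∷_ : ∀ {t u s ts us ss} → Join t u s → Join* ts us ss → Join* (t ∷ ts) (u ∷ us) (s ∷ ss)

mark-join  : ∀ {A} (P Q : Tree A → Bool) t → Join (mark P t) (mark Q t) (mark (λ s → P s ∨ Q s) t)
mark-join* : ∀ {A} (P Q : Tree A → Bool) ts → Join* (mark* P ts) (mark* Q ts) (mark* (λ s → P s ∨ Q s) ts)
mark-join P Q (node a ts) = join refl (mark-join* P Q ts)
mark-join* P Q []       = []
mark-join* P Q (t ∷ ts) = mark-join P Q t ∷ mark-join* P Q ts

left right both : Tree (Bool × Bool) → Bool
left  t = proj₁ (label t)
right t = proj₂ (label t)
both  t = left t ∨ right t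

-- Additivity concerns two variables on one tree. Labels that are pairs of marks hold both
-- valuations, so every join arises from such a tree.
zip  : ∀ {t u s} → Join t u s → Σ[ z ∈ _ ] mark left z ≡ t × mark right z ≡ u × mark both z ≡ s
zip* : ∀ {ts us ss} → Join* ts us ss → Σ[ zs ∈ _ ] mark* left zs ≡ ts × mark* right zs ≡ us × mark* both zs ≡ ss
zip (join {a} {b} e js) = let zs , x , y , z = zip* js in
  node (a , b) zs , cong (node a) x , cong (node b) y , cong₂ node (sym e) z
zip* []       = [] , refl , refl , refl
zip* (j ∷ js) = let z , x , y , w = zip j ; zs , xs , ys , ws = zip* js in
  z ∷ zs , cong₂ _∷_ x xs , cong₂ _∷_ y ys , cong₂ _∷_ w ws

JoinHom : (Tree Bool → Bool) → Set
JoinHom f = ∀ {t u s} → Join t u s → f s ≡ f t ∨ f u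

additive⇒joinHom : ∀ {p q} → p ≢ q → ∀ φ → φ ∈Fm p → Additive Grz p q φ → JoinHom (value φ)
additive⇒joinHom {p} {q} p≢q φ i d j with zip j
... | z , refl , refl , refl =
  trans (sym (sem-instance φ (var p ∨ᶠ var q) i (λ s → cong₂ _∨_ (if-self p (left s) (right s)) (if-other (left s) (right s) p≢q)) z))
  (trans (⇔-sound d v z)
         (cong₂ _∨_ (sem-mark φ i (λ s → if-self p (left s) (right s)) z) (sem-instance φ (var q) i (λ s → if-other (left s) (right s) p≢q) z)))
  where
  v : Valuation {Bool × Bool}
  v t x = if does (x ≟ p) then left t else right t

joinHom⇒additive : ∀ {p q} φ → φ ∈Fm p → JoinHom (value φ) → Additive Grz p q φ
joinHom⇒additive {p} {q} φ i hom = ⇔-complete λ t →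
  trans (sem-instance φ (var p ∨ᶠ var q) i (λ _ → refl) t)
  (trans (hom (mark-join (λ s → label s p) (λ s → label s q) t))
         (sym (cong₂ _∨_ (sem-mark φ i (λ _ → refl) t) (sem-instance φ (var q) i (λ _ → refl) t))))

-- Bisimilarity

-- Bisimilarity enters only through its consequence, equal values of all formulas, which composes
-- without any relation having to be exhibited.
infix 4 _∼_
record _∼_ (t s : Tree Bool) : Set where
  constructor equivalent
  field values : ∀ φ → value φ t ≡ value φ s
open _∼_

Simulated : Tree Bool → Tree Bool → Set
Simulated s t = Σ[ r ∈ Tree Bool ] r ≼ s × t ∼ r

module _ {h : Tree Bool → Bool} where

  SimulatedAt : Tree Bool → Tree Bool → Set
  SimulatedAt s t = Σ[ r ∈ Tree Bool ] r ≼ s × everywhere h t ≡ everywhere h r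

  everywhere-transfer : ∀ {b ts ss} → h (node b ts) ≡ h (node b ss) → All (SimulatedAt (node b ss)) ts →
                        everywhere h (node b ss) ≡ true → everywhere h (node b ts) ≡ true
  everywhere-transfer {b} {ss = ss} e sims all = cong₂ _∧_ (trans e (everywhere-root (node b ss) all)) (children sims)
    where
    children : ∀ {us} → All (SimulatedAt (node b ss)) us → everywhere* h us ≡ true
    children [] = refl
    children ((r , i , e) ∷ sims) =
      cong₂ _∧_ (trans e (everywhere-intro r λ j → everywhere-elim all (≼-trans j i))) (children sims)

  everywhere-∼ : ∀ {b ts ss} → h (node b ts) ≡ h (node b ss) →
                 All (SimulatedAt (node b ss)) ts → All (SimulatedAt (node b ts)) ss →
                 everywhere h (node b ts) ≡ everywhere h (node b ss)
  everywhere-∼ e f g = ≡-by-truth (everywhere-transfer (sym e) g) (everywhere-transfer e f)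

-- Bisimulation invariance, by induction on the formula. For a box, the roots agree by induction,
-- and what holds throughout one tree holds throughout the match of each child of the other. The
-- match may be the root itself, as the order is reflexive.
node-value : ∀ {b ts ss} → All (Simulated (node b ss)) ts → All (Simulated (node b ts)) ss → ∀ φ → value φ (node b ts) ≡ value φ (node b ss)
node-value f g (var x)  = refl
node-value f g ⊥ᶠ       = refl
node-value f g ⊤ᶠ       = refl
node-value f g (φ ∧ᶠ ψ) = cong₂ _∧_ (node-value f g φ) (node-value f g ψ)
node-value f g (φ ∨ᶠ ψ) = cong₂ _∨_ (node-value f g φ) (node-value f g ψ)
node-value f g (φ ⇒ ψ)  = cong₂ (λ a b → not a ∨ b) (node-value f g φ) (node-value f g ψ)
node-value f g (□ φ)    = everywhere-∼ (node-value f g φ) (All.map at f) (All.map at g)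
  where
  at : ∀ {s t} → Simulated s t → SimulatedAt s t
  at (r , i , e) = r , i , values e (□ φ)
node-value f g (◇ φ) = cong not (everywhere-∼ (cong not (node-value f g φ)) (All.map at f) (All.map at g))
  where
  at : ∀ {s t} → Simulated s t → SimulatedAt s t
  at (r , i , e) = r , i , not-injective (values e (◇ φ))

node-∼ : ∀ {b ts ss} → All (Simulated (node b ss)) ts → All (Simulated (node b ts)) ss → node b ts ∼ node b ss
node-∼ f g = equivalent (node-value f g)

∼-refl : ∀ {t} → t ∼ t
∼-refl = equivalent λ φ → refl

∼-sym : ∀ {s t} → s ∼ t → t ∼ s
∼-sym e = equivalent λ φ → sym (values e φ)

∼-trans : ∀ {r s t} → r ∼ s → s ∼ t → r ∼ t
∼-trans e f = equivalent λ φ → trans (values e φ) (values f φ)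

child : ∀ {b t ts} → Any (t ∼_) ts → Simulated (node b ts) t
child {t = t} i = let r , j , e = find i in r , ≼-child (Any.map (λ { refl → ≼-refl }) j) , e

children-∼ : ∀ {b ts ss} → All (λ t → Any (t ∼_) ss) ts → All (λ s → Any (s ∼_) ts) ss → node b ts ∼ node b ss
children-∼ f g = node-∼ (All.map child f) (All.map child g)

-- The first child is matched by the root on the right, so a root that repeats the mark of a child
-- and sees nothing new is redundant.
absorb : ∀ {b ss us} → All (Simulated (node b ss)) us → node b (node b ss ∷ us) ∼ node b ss
absorb {b} {ss} {us} f = node-∼ ((_ , ≼-refl , ∼-refl) ∷ f) (All.tabulate λ {s} i →
  s , ≼-child (here (≼-child (Any.map (λ { refl → ≼-refl }) i))) , ∼-refl)

-- Trees with a single mark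

mutual
  data Dead : Tree Bool → Set where
    dead : ∀ {ts} → Dead* ts → Dead (node false ts)

  data Dead* : List (Tree Bool) → Set where
    []  : Dead* []
    _∷_ : ∀ {t ts} → Dead t → Dead* ts → Dead* (t ∷ ts)

mutual
  data Single : Tree Bool → Set where
    root  : ∀ {ts} → Dead* ts → Single (node true ts)
    above : ∀ {ts} → Single* ts → Single (node false ts)

  data Single* : List (Tree Bool) → Set where
    here  : ∀ {t ts} → Single t → Dead* ts → Single* (t ∷ ts)
    there : ∀ {t ts} → Dead t → Single* ts → Single* (t ∷ ts)

d l chain₁ chain₂ chain₃ fork longFork : Tree Bool
d        = node false []
l        = node true []
chain₁   = node true (d ∷ [])
chain₂   = node false (l ∷ [])
chain₃   = node false (chain₁ ∷ [])
fork     = node false (l ∷ d ∷ [])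
longFork = node false (chain₂ ∷ d ∷ [])

-- In `l` and `chain₁` the mark is at the root. Below a mark that has a node above it everything
-- looks like `chain₃`. Below a marked leaf, `chain₂` has no unmarked leaf, in `fork` the parent of
-- the mark sees one, and in `longFork` only lower nodes do.
shapes : List (Tree Bool)
shapes = l ∷ chain₁ ∷ chain₂ ∷ chain₃ ∷ fork ∷ longFork ∷ []

HasShape : Tree Bool → Set
HasShape t = Any (t ∼_) shapes

dead-∼  : ∀ {t} → Dead t → t ∼ d
dead*-∼ : ∀ {ts} → Dead* ts → All (_∼ d) ts
dead-∼ (dead ds) = node-∼ (All.map (λ e → _ , ≼-refl , e) (dead*-∼ ds)) []
dead*-∼ []       = []
dead*-∼ (e ∷ es) = dead-∼ e ∷ dead*-∼ es

module _ {A : Set} where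

  kill : Tree A → Tree Bool
  kill = mark λ _ → false

  kill* : List (Tree A) → List (Tree Bool)
  kill* = mark* λ _ → false

  kill-dead  : ∀ t → Dead (kill t)
  kill-dead* : ∀ ts → Dead* (kill* ts)
  kill-dead (node a ts) = dead (kill-dead* ts)
  kill-dead* []       = []
  kill-dead* (t ∷ ts) = kill-dead t ∷ kill-dead* ts

join-killˡ  : ∀ t → Join (kill t) t t
join-killˡ* : ∀ ts → Join* (kill* ts) ts ts
join-killˡ (node b ts) = join refl (join-killˡ* ts)
join-killˡ* []       = []
join-killˡ* (t ∷ ts) = join-killˡ t ∷ join-killˡ* ts

join-idem  : ∀ t → Join t t t
join-idem* : ∀ ts → Join* ts ts ts
join-idem (node b ts) = join (sym (∨-idem b)) (join-idem* ts)
join-idem* []       = []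
join-idem* (t ∷ ts) = join-idem t ∷ join-idem* ts

join-killʳ  : ∀ t → Join t (kill t) t
join-killʳ* : ∀ ts → Join* ts (kill* ts) ts
join-killʳ (node b ts) = join (sym (∨-identityʳ b)) (join-killʳ* ts)
join-killʳ* []       = []
join-killʳ* (t ∷ ts) = join-killʳ t ∷ join-killʳ* ts

∨-true : ∀ {a b} → a ∨ b ≡ true → a ≡ true ⊎ b ≡ true
∨-true {true}  _ = inj₁ refl
∨-true {false} e = inj₂ e

-- A join homomorphism that is false on the unmarked tree and true on t stays
-- true on one half when the marks of t are split, hence on some single mark.
single-mark  : ∀ t {f} → JoinHom f → f (kill t) ≡ false → f t ≡ true →
               Σ[ s ∈ _ ] Single s × Join s t t × f s ≡ true
single-mark* : ∀ ts {f : List (Tree Bool) → Bool} → (∀ {ts us ss} → Join* ts us ss → f ss ≡ f ts ∨ f us) →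
               f (kill* ts) ≡ false → f ts ≡ true →
               Σ[ ss ∈ _ ] Single* ss × Join* ss ts ts × f ss ≡ true
single-mark (node b ts) {f} hom dead-false e
  with ∨-true (trans (sym (hom (join (sym (∨-identityʳ b)) (join-killˡ* ts)))) e)
single-mark (node false ts) hom dead-false e | inj₁ e′ = contradictory e′ dead-false
single-mark (node true ts)  hom dead-false e | inj₁ e′ =
  _ , root (kill-dead* ts) , join refl (join-killˡ* ts) , e′
... | inj₂ e′ = let ss , single , j , e″ = single-mark* ts (λ j → hom (join refl j)) dead-false e′ in
  _ , above single , join refl j , e″
single-mark* []       hom dead-false e = contradictory e dead-false
single-mark* (t ∷ ts) hom dead-false e
  with ∨-true (trans (sym (hom (join-killʳ t ∷ join-killˡ* ts))) e)
... | inj₁ e′ = let s , single , j , e″ = single-mark t (λ j → hom (j ∷ join-idem* (kill* ts))) dead-false e′ in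
  _ , here single (kill-dead* ts) , j ∷ join-killˡ* ts , e″
... | inj₂ e′ = let ss , single , j , e″ = single-mark* ts (λ j → hom (join-idem (kill t) ∷ j)) dead-false e′ in
  _ , there (kill-dead t) single , join-killˡ t ∷ j , e″

-- The induction step down the path from the mark to the root. A new unmarked root is absorbed
-- unless the old root is marked or an unmarked leaf becomes visible for the first time.
shape-above : All (λ t → HasShape (node false (t ∷ [])) × HasShape (node false (t ∷ d ∷ []))) shapes
shape-above
  = (at₂ ∼-refl , at₄ ∼-refl)
  ∷ (at₃ ∼-refl , at₃ (node-∼ (child (here ∼-refl) ∷ (d , ≼-child (here (≼-child (here ≼-refl))) , ∼-refl) ∷ [])
                              (child (here ∼-refl) ∷ [])))
  ∷ (at₂ (absorb []) , at₅ ∼-refl)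
  ∷ (at₃ (absorb []) , at₃ (absorb ((d , ≼-child (here (≼-child (here ≼-refl))) , ∼-refl) ∷ [])))
  ∷ (at₄ (absorb []) , at₄ (absorb (child (there (here ∼-refl)) ∷ [])))
  ∷ (at₅ (absorb []) , at₅ (absorb (child (there (here ∼-refl)) ∷ [])))
  ∷ []
  where
  at₂ : ∀ {t} → t ∼ chain₂ → HasShape t
  at₂ e = there (there (here e))

  at₃ : ∀ {t} → t ∼ chain₃ → HasShape t
  at₃ e = there (there (there (here e)))

  at₄ : ∀ {t} → t ∼ fork → HasShape t
  at₄ e = there (there (there (there (here e))))

  at₅ : ∀ {t} → t ∼ longFork → HasShape t
  at₅ e = there (there (there (there (there (here e)))))

HasShape-resp : ∀ {s t} → s ∼ t → HasShape t → HasShape s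
HasShape-resp e = Any.map (∼-trans e)

Covers : List (Tree Bool) → List (Tree Bool) → Set
Covers ss ts = All (λ t → Any (t ∼_) ss) ts × All (λ s → Any (s ∼_) ts) ss

covers-dead : ∀ {s t ts} → Dead t → Covers (s ∷ []) ts ⊎ Covers (s ∷ d ∷ []) ts → Covers (s ∷ d ∷ []) (t ∷ ts)
covers-dead δ (inj₁ (f , g ∷ [])) =
  there (here (dead-∼ δ)) ∷ All.map (λ { (here e) → here e }) f , there g ∷ here (∼-sym (dead-∼ δ)) ∷ []
covers-dead δ (inj₂ (f , g ∷ _)) =
  there (here (dead-∼ δ)) ∷ f , there g ∷ here (∼-sym (dead-∼ δ)) ∷ []

-- Up to `∼`, the children of an unmarked root with one mark above it are one shape and possibly
-- `d`, so `shape-above` covers all cases.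
single-shape  : ∀ {t} → Single t → HasShape t
single*-shape : ∀ {ts} → Single* ts → Σ[ s ∈ _ ] s ∈ shapes × (Covers (s ∷ []) ts ⊎ Covers (s ∷ d ∷ []) ts)
single-shape (root []) = here ∼-refl
single-shape (root ds@(_ ∷ _)) with dead*-∼ ds
... | e ∷ es = there (here (children-∼ (All.map here (e ∷ es)) (here (∼-sym e) ∷ [])))
single-shape (above single) with single*-shape single
... | s , i , inj₁ (f , g) = HasShape-resp (children-∼ f g) (proj₁ (All.lookup shape-above i))
... | s , i , inj₂ (f , g) = HasShape-resp (children-∼ f g) (proj₂ (All.lookup shape-above i))
single*-shape (here single ds) with find (single-shape single) | dead*-∼ ds
... | s , i , e | []     = s , i , inj₁ (here e ∷ [] , here (∼-sym e) ∷ [])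
... | s , i , e | f ∷ fs = s , i , inj₂ (here e ∷ All.map (λ g → there (here g)) (f ∷ fs)
                                        , here (∼-sym e) ∷ there (here (∼-sym f)) ∷ [])
single*-shape (there δ single) = let s , i , c = single*-shape single in s , i , inj₂ (covers-dead δ c)

-- Determination by four values

swap-∼ : ∀ {b s t} → node b (s ∷ t ∷ []) ∼ node b (t ∷ s ∷ [])
swap-∼ = children-∼ (there (here ∼-refl) ∷ here ∼-refl ∷ []) (there (here ∼-refl) ∷ here ∼-refl ∷ [])

module _ (φ : Fm) (hom : JoinHom (value φ)) where

  -- In each case a tree bisimilar to the shape on one side has its marks split
  -- into two parts, each of which leaves a tree bisimilar to one of the shapes.
  value-l : value φ l ≡ value φ chain₁ ∨ value φ chain₂
  value-l = trans (sym (values (absorb []) φ)) (hom (join refl (join refl [] ∷ [])))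

  -- In `chain₂` the marked leaf is doubled; erasing either mark leaves a fork.
  value-fork : value φ fork ≡ value φ chain₂
  value-fork = sym (trans (sym (values (children-∼ (here ∼-refl ∷ here ∼-refl ∷ []) (here ∼-refl ∷ [])) φ))
    (trans (hom {fork} {node false (d ∷ l ∷ [])} (join refl (join refl [] ∷ join refl [] ∷ [])))
           (trans (cong (value φ fork ∨_) (values swap-∼ φ)) (∨-idem _))))

  -- Two copies of `chain₂` above an unmarked root are bisimilar to `chain₂`; erasing the mark of
  -- either copy leaves a long fork.
  value-longFork : value φ longFork ≡ value φ chain₂
  value-longFork = sym (trans (sym (values (absorb ((chain₂ , ≼-refl , ∼-refl) ∷ [])) φ))
    (trans (hom {node false (chain₂ ∷ node false (d ∷ []) ∷ [])} {node false (node false (d ∷ []) ∷ chain₂ ∷ [])}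
             (join refl (join refl (join refl [] ∷ []) ∷ join refl (join refl [] ∷ []) ∷ [])))
    (trans (cong₂ _∨_ (values half φ) (trans (values swap-∼ φ) (values half φ))) (∨-idem _))))
    where
    half : node false (chain₂ ∷ node false (d ∷ []) ∷ []) ∼ longFork
    half = children-∼ (here ∼-refl ∷ there (here (absorb [])) ∷ []) (here ∼-refl ∷ there (here (∼-sym (absorb []))) ∷ [])

  -- `chain₁` is bisimilar to a tree in which a second copy of it sits above the marked root, beside
  -- `d`; the mark of that copy alone gives `chain₃`.
  value-chain₃-chain₁ : value φ chain₃ ≡ true → value φ chain₁ ≡ true
  value-chain₃-chain₁ e = trans (sym (values (absorb ((d , ≼-child (here ≼-refl) , ∼-refl) ∷ [])) φ))
    (trans (hom {chain₃′} {node true (node false (d ∷ []) ∷ d ∷ [])} {node true (chain₁ ∷ d ∷ [])}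
             (join refl (join refl (join refl [] ∷ []) ∷ join refl [] ∷ [])))
           (cong (_∨ value φ (node true (node false (d ∷ []) ∷ d ∷ []))) (trans (values chain₃′∼ φ) e)))
    where
    chain₃′ = node false (chain₁ ∷ d ∷ [])

    chain₃′∼ : chain₃′ ∼ chain₃
    chain₃′∼ = node-∼ (child (here ∼-refl) ∷ (d , ≼-child (here (≼-child (here ≼-refl))) , ∼-refl) ∷ [])
                      (child (here ∼-refl) ∷ [])

  -- Doubling the marked top of `chain₂` into a chain gives a 3-chain with two marks, and the lower
  -- of these alone gives `chain₃`.
  value-chain₃-chain₂ : value φ chain₃ ≡ true → value φ chain₂ ≡ true
  value-chain₃-chain₂ e = trans (sym (values (children-∼ (here (absorb []) ∷ []) (here (∼-sym (absorb [])) ∷ [])) φ))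
    (trans (hom {chain₃} {node false (chain₂ ∷ [])} (join refl (join refl (join refl [] ∷ []) ∷ [])))
           (cong (_∨ value φ (node false (chain₂ ∷ []))) e))

module _ (φ ψ : Fm) (homφ : JoinHom (value φ)) (homψ : JoinHom (value ψ)) where

  shapes-agree : value φ chain₁ ≡ value ψ chain₁ → value φ chain₂ ≡ value ψ chain₂ → value φ chain₃ ≡ value ψ chain₃ →
                 All (λ s → value φ s ≡ value ψ s) shapes
  shapes-agree e₁ e₂ e₃
    = trans (value-l φ homφ) (trans (cong₂ _∨_ e₁ e₂) (sym (value-l ψ homψ)))
    ∷ e₁ ∷ e₂ ∷ e₃
    ∷ trans (value-fork φ homφ) (trans e₂ (sym (value-fork ψ homψ)))
    ∷ trans (value-longFork φ homφ) (trans e₂ (sym (value-longFork ψ homψ)))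
    ∷ []

  shapes-determine : value φ d ≡ false → All (λ s → value φ s ≡ value ψ s) shapes →
                     ∀ t → value φ t ≡ true → value ψ t ≡ true
  shapes-determine e₀ es t e
    with single-mark t homφ (trans (values (dead-∼ (kill-dead t)) φ) e₀) e
  ... | s , single , j , e′ with find (single-shape single)
  -- `j : Join s t t` says that `s` arises from `t` by erasing marks, so `homψ j` carries truth of
  -- `ψ` from `s` back to `t`.
  ...   | r , i , s∼r = trans (homψ j) (cong (_∨ value ψ t)
            (trans (values s∼r ψ) (trans (sym (All.lookup es i)) (trans (sym (values s∼r φ)) e′))))

values-determine : ∀ φ ψ → JoinHom (value φ) → JoinHom (value ψ) → value φ d ≡ false → value ψ d ≡ false →
                   value φ chain₁ ≡ value ψ chain₁ → value φ chain₂ ≡ value ψ chain₂ →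
                   value φ chain₃ ≡ value ψ chain₃ → ∀ t → value φ t ≡ value ψ t
values-determine φ ψ homφ homψ d₁ d₂ e₁ e₂ e₃ t = ≡-by-truth
  (shapes-determine φ ψ homφ homψ d₁ (shapes-agree φ ψ homφ homψ e₁ e₂ e₃) t)
  (shapes-determine ψ φ homψ homφ d₂ (shapes-agree ψ φ homψ homφ (sym e₁) (sym e₂) (sym e₃)) t)

value-top : ∀ φ → JoinHom (value φ) → value φ d ≡ true → ∀ t → value φ t ≡ true
value-top φ hom e t = trans (hom (join-killˡ t)) (cong (_∨ value φ t) (trans (values (dead-∼ (kill-dead t)) φ) e))

-- The six formulas

nowhere : Tree Bool → Bool
nowhere = everywhere (not ∘ label)

nowhere-join  : ∀ {t u s} → Join t u s → nowhere s ≡ nowhere t ∧ nowhere u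
nowhere-join* : ∀ {ts us ss} → Join* ts us ss →
                everywhere* (not ∘ label) ss ≡ everywhere* (not ∘ label) ts ∧ everywhere* (not ∘ label) us
nowhere-join (join {a} {b} refl js) =
  trans (cong₂ _∧_ (deMorgan₂ a b) (nowhere-join* js)) (∧-interchange (not a) (not b) _ _)
nowhere-join* []       = refl
nowhere-join* (_∷_ {t} {u} j js) =
  trans (cong₂ _∧_ (nowhere-join j) (nowhere-join* js)) (∧-interchange (nowhere t) (nowhere u) _ _)

-- The value of □ ◇ ¬ p: no leaf of t is marked.
unmarkedTops : Tree Bool → Bool
unmarkedTops = everywhere (not ∘ everywhere label)

unmarkedTops* : List (Tree Bool) → Bool
unmarkedTops* = everywhere* (not ∘ everywhere label)

-- An inner node adds no condition: its first child is already required to see an unmarked node.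
-- Only leaves count, and there the claim about joins is de Morgan's law for a single mark.
unmarkedTops-∷ : ∀ a t ts → unmarkedTops (node a (t ∷ ts)) ≡ unmarkedTops* (t ∷ ts)
unmarkedTops-∷ a (node b us) ts =
  absorbed a (everywhere label (node b us)) (everywhere* label ts) (unmarkedTops* us) (unmarkedTops* ts)
  where
  absorbed : ∀ a e f m n → not (a ∧ (e ∧ f)) ∧ ((not e ∧ m) ∧ n) ≡ (not e ∧ m) ∧ n
  absorbed true  true  f m n = ∧-zeroʳ _
  absorbed true  false f m n = refl
  absorbed false e     f m n = refl

unmarkedTops-join  : ∀ {t u s} → Join t u s → unmarkedTops s ≡ unmarkedTops t ∧ unmarkedTops u
unmarkedTops-join* : ∀ {ts us ss} → Join* ts us ss → unmarkedTops* ss ≡ unmarkedTops* ts ∧ unmarkedTops* us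
unmarkedTops-join (join {true}  refl []) = refl
unmarkedTops-join (join {false} refl []) = refl
unmarkedTops-join (join {a} {b} {c} {t ∷ ts} {u ∷ us} {s ∷ ss} _ (j ∷ js)) =
  trans (unmarkedTops-∷ c s ss) (trans (unmarkedTops-join* (j ∷ js))
    (sym (cong₂ _∧_ (unmarkedTops-∷ a t ts) (unmarkedTops-∷ b u us))))
unmarkedTops-join* []       = refl
unmarkedTops-join* (_∷_ {t} {u} j js) =
  trans (cong₂ _∧_ (unmarkedTops-join j) (unmarkedTops-join* js)) (∧-interchange (unmarkedTops t) (unmarkedTops u) _ _)

not-joinHom : ∀ {f} → (∀ {t u s} → Join t u s → f s ≡ f t ∧ f u) → JoinHom (not ∘ f)
not-joinHom {f} h {t} {u} j = trans (cong not (h j)) (deMorgan₁ (f t) (f u))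

∨-joinHom : ∀ {f g} → JoinHom f → JoinHom g → JoinHom (λ t → f t ∨ g t)
∨-joinHom {f} {g} hf hg {t} {u} j = trans (cong₂ _∨_ (hf j) (hg j)) (∨-interchange (f t) (f u) (g t) (g u))

label-joinHom : JoinHom label
label-joinHom (join e _) = e

six-joinHom : ∀ p → All (λ φ → JoinHom (value φ)) (sixFormulas p)
six-joinHom p = (λ _ → refl)
              ∷ label-joinHom
              ∷ (λ j → not-joinHom {nowhere} nowhere-join j)
              ∷ (λ _ → refl)
              ∷ (λ j → not-joinHom {unmarkedTops} unmarkedTops-join j)
              ∷ ∨-joinHom {not ∘ unmarkedTops} {label} (not-joinHom {unmarkedTops} unmarkedTops-join) label-joinHom
              ∷ []

six-∈Fm : ∀ p → All (_∈Fm p) (sixFormulas p)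
six-∈Fm p = tt ∷ refl ∷ refl ∷ tt ∷ refl ∷ (refl , refl) ∷ []

six-additive : ∀ p q → All (λ φ → (φ ∈Fm p) × Additive Grz p q φ) (sixFormulas p)
six-additive p q = All.map (λ {φ} (i , hom) → i , joinHom⇒additive φ i hom) (All.zip (six-∈Fm p , six-joinHom p))

-- Inequivalence, exhaustiveness and normality

separated : ∀ {φ ψ} t → value φ t ≢ value ψ t → ¬ Equivalent Grz φ ψ
separated t ne d = ne (⇔-sound d _ t)

-- The values on `d`, `chain₁`, `chain₂`, `chain₃` are 0000 for ⊥, 0100 for p, 0111 for ◇p, 1111 for
-- ⊤, 0010 for ◇□p and 0110 for ◇□p ∨ p. Each witness is a column where two rows differ.
six-inequivalent : ∀ p → AllPairs (λ φ ψ → ¬ Equivalent Grz φ ψ) (sixFormulas p)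
six-inequivalent p
  = (separated chain₁ (λ ()) ∷ separated chain₁ (λ ()) ∷ separated d (λ ())
     ∷ separated chain₂ (λ ()) ∷ separated chain₁ (λ ()) ∷ [])
  ∷ (separated chain₂ (λ ()) ∷ separated d (λ ()) ∷ separated chain₂ (λ ()) ∷ separated chain₂ (λ ()) ∷ [])
  ∷ (separated d (λ ()) ∷ separated chain₁ (λ ()) ∷ separated chain₃ (λ ()) ∷ [])
  ∷ (separated d (λ ()) ∷ separated d (λ ()) ∷ [])
  ∷ (separated chain₁ (λ ()) ∷ [])
  ∷ []
  ∷ []

six-exhaustive : ∀ {p} φ → φ ∈Fm p → JoinHom (value φ) → Any (Equivalent Grz φ) (sixFormulas p)
six-exhaustive {p} φ φ∈ hom =
  result (value φ d) (value φ chain₁) (value φ chain₂) (value φ chain₃) refl refl refl refl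
  where
  Claim : Set
  Claim = Any (Equivalent Grz φ) (sixFormulas p)

  equal : ∀ {ψ} → ψ ∈ sixFormulas p → (∀ t → value φ t ≡ value ψ t) → Claim
  equal {ψ} i h = lose i (value-complete φ ψ φ∈ (All.lookup (six-∈Fm p) i) h)

  normal : ∀ {ψ} → ψ ∈ sixFormulas p → value φ d ≡ false → value ψ d ≡ false →
           value φ chain₁ ≡ value ψ chain₁ → value φ chain₂ ≡ value ψ chain₂ →
           value φ chain₃ ≡ value ψ chain₃ → Claim
  normal {ψ} i d₁ d₂ e₁ e₂ e₃ =
    equal i (values-determine φ ψ hom (All.lookup (six-joinHom p) i) d₁ d₂ e₁ e₂ e₃)

  result : ∀ b a₁ a₂ a₃ → value φ d ≡ b → value φ chain₁ ≡ a₁ → value φ chain₂ ≡ a₂ → value φ chain₃ ≡ a₃ → Claim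
  result true  _     _     _     e₀ e₁ e₂ e₃ = equal (there (there (there (here refl)))) (value-top φ hom e₀)
  result false false false false e₀ e₁ e₂ e₃ = normal (here refl) e₀ refl e₁ e₂ e₃
  result false true  false false e₀ e₁ e₂ e₃ = normal (there (here refl)) e₀ refl e₁ e₂ e₃
  result false true  true  true  e₀ e₁ e₂ e₃ = normal (there (there (here refl))) e₀ refl e₁ e₂ e₃
  result false false true  false e₀ e₁ e₂ e₃ = normal (there (there (there (there (here refl))))) e₀ refl e₁ e₂ e₃
  result false true  true  false e₀ e₁ e₂ e₃ = normal (there (there (there (there (there (here refl)))))) e₀ refl e₁ e₂ e₃
  result false false _     true  e₀ e₁ e₂ e₃ = contradictory (value-chain₃-chain₁ φ hom e₃) e₁
  result false true  false true  e₀ e₁ e₂ e₃ = contradictory (value-chain₃-chain₂ φ hom e₃) e₂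

module _ {p : Var} (φ : Fm) (φ∈ : φ ∈Fm p) where

  -- Substituting ⊥ erases all marks, and every unmarked tree is equivalent to `d`, so normality is
  -- decided by a single value.
  normal⇐ : value φ d ≡ false → NormalIn Grz p φ
  normal⇐ e = ⇔-complete λ t →
    trans (sem-instance φ ⊥ᶠ φ∈ (λ _ → refl) t) (trans (values (dead-∼ (kill-dead t)) φ) e)

  normal⇒ : NormalIn Grz p φ → value φ d ≡ false
  normal⇒ n = trans (sym (sem-instance {v = λ t _ → label t} φ ⊥ᶠ φ∈ (λ _ → refl) d)) (⇔-sound n _ d)

six-normal : ∀ p φ → φ ∈ sixFormulas p → NormalIn Grz p φ ⇔ (φ ≢ ⊤ᶠ)
six-normal p φ i = mk⇔ (λ { n refl → contradictory refl (normal⇒ {p} ⊤ᶠ tt n) })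
                       (λ ne → normal⇐ φ (All.lookup (six-∈Fm p) i) (value-d i ne))
  where
  value-d : φ ∈ sixFormulas p → φ ≢ ⊤ᶠ → value φ d ≡ false
  value-d (here refl)                                         ne = refl
  value-d (there (here refl))                                 ne = refl
  value-d (there (there (here refl)))                         ne = refl
  value-d (there (there (there (here refl))))                 ne = ⊥-elim (ne refl)
  value-d (there (there (there (there (here refl)))))         ne = refl
  value-d (there (there (there (there (there (here refl)))))) ne = refl

theorem6p4 : (p q : Var) → p ≢ q →
    All (λ φ → (φ ∈Fm p) × Additive Grz p q φ) (sixFormulas p)
    × AllPairs (λ φ ψ → ¬ Equivalent Grz φ ψ) (sixFormulas p)
    × (∀ φ → φ ∈Fm p → Additive Grz p q φ → Any (Equivalent Grz φ) (sixFormulas p))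
    × (∀ φ → φ ∈ sixFormulas p → NormalIn Grz p φ ⇔ (φ ≢ ⊤ᶠ))
theorem6p4 p q p≢q = six-additive p q
                   , six-inequivalent p
                   , (λ φ φ∈ additive → six-exhaustive φ φ∈ (additive⇒joinHom p≢q φ φ∈ additive))
                   , six-normal p
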